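{- Let $T$ be a tree on $n$ vertices which is not a path. Then $\kappa(T)=\min\{n,\kappa^{\ast}(T)\}$. In particular, if $T$ is not of the form $S^{3}(l_{1},l_{2},l_{3})$, then $\kappa(T)=\kappa^{\ast}(T)$.
   Context: All graphs are finite, simple and connected; $d(u,v)$ is the shortest-path distance. For vertices $x,y,s$ put $\Delta_s(x,y)=|d(x,s)-d(y,s)|$ and for $S\subseteq V(G)$ put $\Delta_S(x,y)=\sum_{s\in S}\Delta_s(x,y)$. For an integer $k\ge 1$, a set $S\subseteq V(G)$ is a weak $k$-resolving set of $G$ if $\Delta_S(x,y)\ge k$ for every pair of distinct vertices $x,y\in V(G)$. $\kappa(G)$ denotes the largest integer $k$ such that $G$ has a weak $k$-resolving set. In a tree $T$, for a vertex $v$ of degree at least $3$, a thread of length $l$ hanging at $v$ is a path $vv_1\cdots v_l$ in $T$ with $\deg(v_i)=2$ for $1\le i\le l-1$ and $\deg(v_l)=1$. A vertex $v$ of degree at least 3 at which at least two threads hang is a root vertex; the number $\ell(v)\ge 2$ of threads hanging at it is its root degree, and $l_1(v)\le l_2(v)\le\cdots\le l_{\ell(v)}(v)$ are the lengths of these threads. $R(T)$ is the set of root vertices, and $\kappa^{\ast}(T)=\min\{2(l_1(v)+l_2(v)) : v\in R(T)\}$. $S^{3}(l_1,l_2,l_3)$ denotes a tree with exactly one root vertex, of root degree $3$, with thread lengths $l_1\le l_2\le l_3$ (i.e. a tree obtained from the star $K_{1,3}$ by subdividing its edges). -}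

module Defs where

open import Data.Nat using (ℕ; zero; suc; _+_; _*_; _≤_; ∣_-_∣)
open import Data.Bool using (Bool; true; false; if_then_else_; _∨_; _∧_)
open import Data.Fin using (Fin; toℕ; _≟_)
open import Data.Fin.Subset using (Subset)
open import Data.Vec using (lookup)
open import Data.List using (List; []; _∷_; _++_; [_]; map; allFin)
open import Data.Nat.ListAction using (sum)
open import Data.Bool.ListAction using (any)
open import Data.List.Relation.Unary.All using (All)
open import Data.List.Relation.Unary.Linked using (Linked)
open import Data.List.Relation.Unary.Unique.Propositional using (Unique)
open import Data.Product using (Σ; ∃; ∃-syntax; _×_; _,_)
open import Data.Sum using (_⊎_)
open import Relation.Nullary using (¬_)
open import Relation.Nullary.Decidable using (⌊_⌋)
open import Relation.Binary.PropositionalEquality using (_≡_; _≢_)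
open import Function using (Injective)
open import Function.Bundles using (_⇔_)

record Graph (n : ℕ) : Set where
  field
    adj     : Fin n → Fin n → Bool
    adj-sym : ∀ u v → adj u v ≡ adj v u
    adj-irr : ∀ u → adj u u ≡ false
open Graph public

module _ {n : ℕ} (G : Graph n) where

  Adj : Fin n → Fin n → Set
  Adj u v = adj G u v ≡ true

  deg : Fin n → ℕ
  deg v = sum (map (λ w → if adj G v w then 1 else 0) (allFin n))

  data Walk : Fin n → Fin n → ℕ → Set where
    here : ∀ {u} → Walk u u 0
    step : ∀ {u w v k} → Adj u w → Walk w v k → Walk u v (suc k)

  Connected : Set
  Connected = ∀ u v → ∃[ k ] Walk u v k

  HasCycle : Set
  HasCycle = ∃[ x ] ∃[ y ] ∃[ z ] ∃[ rest ]
    (Unique (x ∷ y ∷ z ∷ rest) × Linked Adj (x ∷ y ∷ z ∷ rest ++ [ x ]))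

  IsTree : Set
  IsTree = Connected × ¬ HasCycle

  IsPathGraph : Set
  IsPathGraph = Σ (Fin n → Fin n) λ f → Injective _≡_ _≡_ f ×
    (∀ i j → Adj (f i) (f j) ⇔ (suc (toℕ i) ≡ toℕ j ⊎ suc (toℕ j) ≡ toℕ i))

  reach : ℕ → Fin n → Fin n → Bool
  reach zero    u v = ⌊ u ≟ v ⌋
  reach (suc k) u v = reach k u v ∨ any (λ w → reach k u w ∧ adj G w v) (allFin n)

  firstTrue : (ℕ → Bool) → ℕ → ℕ → ℕ
  firstTrue p k zero    = k
  firstTrue p k (suc f) = if p k then k else firstTrue p (suc k) f

  -- shortest-path distance (correct for connected graphs, where d(u,v) ≤ n - 1)
  dist : Fin n → Fin n → ℕ
  dist u v = firstTrue (λ k → reach k u v) 0 n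

  ΔS : Subset n → Fin n → Fin n → ℕ
  ΔS S x y = sum (map (λ s → if lookup S s then ∣ dist x s - dist y s ∣ else 0) (allFin n))

  WeakResolving : ℕ → Subset n → Set
  WeakResolving k S = ∀ x y → x ≢ y → k ≤ ΔS S x y

  IsKappa : ℕ → Set
  IsKappa k = 1 ≤ k × (∃[ S ] WeakResolving k S) ×
              (∀ k' S → 1 ≤ k' → WeakResolving k' S → k' ≤ k)

  -- A thread hanging at v: the path v (us ++ [w]) where us = v₁ … v_{l-1}, w = v_l;
  -- deg v ≥ 3, the path is a path (distinct vertices, consecutive adjacent),
  -- deg vᵢ = 2 for 1 ≤ i ≤ l-1, deg v_l = 1.  Its length is length us + 1.
  Thread : Fin n → List (Fin n) → Fin n → Set
  Thread v us w = 3 ≤ deg v × Unique (v ∷ us ++ [ w ]) × Linked Adj (v ∷ us ++ [ w ]) ×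
                  All (λ x → deg x ≡ 2) us × deg w ≡ 1

  -- first vertex v₁ of a thread (threads at v are distinct iff their first vertices differ)
  first : List (Fin n) → Fin n → Fin n
  first []      w = w
  first (x ∷ _) w = x

  threadLen : List (Fin n) → ℕ
  threadLen us = suc (Data.List.length us)

  IsRoot : Fin n → Set
  IsRoot v = ∃[ us₁ ] ∃[ w₁ ] ∃[ us₂ ] ∃[ w₂ ]
    (Thread v us₁ w₁ × Thread v us₂ w₂ × first us₁ w₁ ≢ first us₂ w₂)

  RootDeg3 : Fin n → Set
  RootDeg3 v = ∃[ us₁ ] ∃[ w₁ ] ∃[ us₂ ] ∃[ w₂ ] ∃[ us₃ ] ∃[ w₃ ]
    (Thread v us₁ w₁ × Thread v us₂ w₂ × Thread v us₃ w₃ ×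
     first us₁ w₁ ≢ first us₂ w₂ × first us₁ w₁ ≢ first us₃ w₃ × first us₂ w₂ ≢ first us₃ w₃ ×
     (∀ us w → Thread v us w →
        first us w ≡ first us₁ w₁ ⊎ first us w ≡ first us₂ w₂ ⊎ first us w ≡ first us₃ w₃))

  IsS3 : Set
  IsS3 = ∃[ v ] (IsRoot v × RootDeg3 v × (∀ u → IsRoot u → u ≡ v))

  IsKappaStar : ℕ → Set
  IsKappaStar c =
    (∃[ v ] ∃[ us₁ ] ∃[ w₁ ] ∃[ us₂ ] ∃[ w₂ ]
      (Thread v us₁ w₁ × Thread v us₂ w₂ × first us₁ w₁ ≢ first us₂ w₂ ×
       c ≡ 2 * (threadLen us₁ + threadLen us₂))) ×
    (∀ v us₁ w₁ us₂ w₂ → Thread v us₁ w₁ → Thread v us₂ w₂ → first us₁ w₁ ≢ first us₂ w₂ →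
       c ≤ 2 * (threadLen us₁ + threadLen us₂))

{- Removing an edge zw splits the tree; write size z w for the number of vertices on w's side.
Every size z w is either the length of a thread hanging at z (when z is a branch vertex), or at
least l₁(u) + l₂(u) for a root vertex u on w's side, hence 2 size z w ≥ κ*.

Upper bound: an edge xy is separated by at most 1 by each vertex, giving κ ≤ n; the first vertices
of two threads at a root are separated only by the vertices of these threads, and by 2 each.
Lower bound, with S = V: if no vertex is equidistant from x and y, each contributes at least 1.
Otherwise x and y hang at equal distances from some z behind distinct neighbours a and b, and every
vertex on the side of a or b contributes at least 2, so Δ ≥ 2 (size z a + size z b).

If n < κ*, two disjoint vertex sets cannot both have κ*/2 or more elements. This excludes a fourth thread or
a non-thread branch at a root, as well as two threads at another root, so the tree is an S³. -}

module Submission where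

open import Defs
open import Data.Nat
  using (ℕ; zero; suc; _+_; _*_; _∸_; _⊓_; _≤_; _<_; z≤n; s≤s; ∣_-_∣; _≤?_)
open import Data.Nat.Induction using (<-wellFounded)
open import Data.Nat.ListAction using (sum)
open import Data.Nat.Properties renaming (_≟_ to _≟ℕ_)
open import Data.Bool using (true; false; if_then_else_; T)
open import Data.Bool.Properties using (T-≡; T-∧; T-∨) renaming (_≟_ to _≟ᵇ_)
open import Data.Empty using (⊥-elim)
open import Data.Fin as Fin using (Fin; toℕ; _≟_)
open import Data.Fin.Properties using (any?; pigeonhole; toℕ<n)
open import Data.Fin.Subset using (⊤)
open import Data.List using (List; []; _∷_; _++_; [_]; map; allFin; tabulate; length)
open import Data.List.Membership.Propositional using (lose)
open import Data.List.Membership.Propositional.Properties using (∈-allFin)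
open import Data.List.Properties using (map-tabulate; length-tabulate)
open import Data.List.Relation.Unary.All as All using (All; []; _∷_)
import Data.List.Relation.Unary.All.Properties as All
open import Data.List.Relation.Unary.AllPairs using ([]; _∷_)
import Data.List.Relation.Unary.AllPairs.Properties as AllPairs
import Data.List.Relation.Unary.Any as Any
open import Data.List.Relation.Unary.Any.Properties using (any⁺; any⁻)
open import Data.List.Relation.Unary.Linked using (Linked; []; [-]; _∷_)
open import Data.List.Relation.Unary.Unique.Propositional using (Unique)
open import Data.Product using (∃-syntax; _×_; _,_; proj₁; proj₂)
open import Data.Sum as Sum using (_⊎_; inj₁; inj₂)
open import Data.Vec using (lookup)
open import Data.Vec.Properties using (lookup-replicate)
open import Function using (_∘_; id)
open import Function.Bundles using (Equivalence)
open import Induction.WellFounded using (Acc; acc)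
open import Level using (0ℓ)
open import Relation.Binary.Definitions using (tri<; tri≈; tri>)
open import Relation.Binary.PropositionalEquality hiding ([_])
open import Relation.Nullary using (¬_; Dec; yes; no; does; contradiction)
open import Relation.Nullary.Decidable
  using (dec-true; toWitness; fromWitness; _⊎-dec_; _×-dec_; ¬?)
open import Relation.Unary using (Pred; Decidable; _⊆_; _∪_; _∩_; Empty)
open import Relation.Unary.Properties using (_∪?_)

private
  variable
    n : ℕ

-- Sums over `Fin n` and cardinalities of decidable subsets.

module Counting where

  ∑ : (Fin n → ℕ) → ℕ
  ∑ f = sum (map f (allFin _))

  ∑-mono : {f g : Fin n → ℕ} → (∀ i → f i ≤ g i) → ∑ f ≤ ∑ g
  ∑-mono {f = f} {g} f≤g = go (allFin _)
    where
    go : ∀ is → sum (map f is) ≤ sum (map g is)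
    go []       = z≤n
    go (i ∷ is) = +-mono-≤ (f≤g i) (go is)

  ∑-cong : {f g : Fin n → ℕ} → (∀ i → f i ≡ g i) → ∑ f ≡ ∑ g
  ∑-cong f≗g = ≤-antisym (∑-mono (≤-reflexive ∘ f≗g)) (∑-mono (≤-reflexive ∘ sym ∘ f≗g))

  ∑-+ : (f g : Fin n → ℕ) → ∑ f + ∑ g ≡ ∑ (λ i → f i + g i)
  ∑-+ f g = go (allFin _)
    where
    go : ∀ is → sum (map f is) + sum (map g is) ≡ sum (map (λ i → f i + g i) is)
    go []       = refl
    go (i ∷ is) = begin
      (f i + sum (map f is)) + (g i + sum (map g is)) ≡⟨ +-assoc (f i) _ _ ⟩
      f i + (sum (map f is) + (g i + sum (map g is))) ≡⟨ cong (f i +_) (+-comm (sum (map f is)) _) ⟩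
      f i + ((g i + sum (map g is)) + sum (map f is)) ≡⟨ cong (f i +_) (+-assoc (g i) _ _) ⟩
      f i + (g i + (sum (map g is) + sum (map f is))) ≡⟨ +-assoc (f i) _ _ ⟨
      (f i + g i) + (sum (map g is) + sum (map f is)) ≡⟨ cong ((f i + g i) +_) (+-comm (sum (map g is)) _) ⟩
      (f i + g i) + (sum (map f is) + sum (map g is)) ≡⟨ cong ((f i + g i) +_) (go is) ⟩
      (f i + g i) + sum (map (λ i → f i + g i) is)    ∎
      where open ≡-Reasoning

  ∑-* : ∀ k (f : Fin n → ℕ) → ∑ (λ i → k * f i) ≡ k * ∑ f
  ∑-* k f = go (allFin _)
    where
    go : ∀ is → sum (map (λ i → k * f i) is) ≡ k * sum (map f is)
    go []       = sym (*-zeroʳ k)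
    go (i ∷ is) = trans (cong (k * f i +_) (go is)) (sym (*-distribˡ-+ k (f i) _))

  ∑-1 : ∑ {n} (λ _ → 1) ≡ n
  ∑-1 {n} = trans (go (allFin n)) (length-tabulate id)
    where
    go : (is : List (Fin n)) → sum (map (λ _ → 1) is) ≡ length is
    go []       = refl
    go (i ∷ is) = cong suc (go is)

  ∑≤n : {f : Fin n → ℕ} → (∀ i → f i ≤ 1) → ∑ f ≤ n
  ∑≤n {f = f} f≤1 = subst (∑ f ≤_) ∑-1 (∑-mono f≤1)

  n≤∑ : {f : Fin n → ℕ} → (∀ i → 1 ≤ f i) → n ≤ ∑ f
  n≤∑ {f = f} 1≤f = subst (_≤ ∑ f) ∑-1 (∑-mono 1≤f)

  𝟙 : {P : Set} → Dec P → ℕ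
  𝟙 P? = if does P? then 1 else 0

  𝟙-yes : {P : Set} (P? : Dec P) → P → 𝟙 P? ≡ 1
  𝟙-yes P? p rewrite dec-true P? p = refl

  χ : {P : Pred (Fin n) 0ℓ} → Decidable P → Fin n → ℕ
  χ P? i = 𝟙 (P? i)

  # : {P : Pred (Fin n) 0ℓ} → Decidable P → ℕ
  # P? = ∑ (χ P?)

  module _ {P : Pred (Fin n) 0ℓ} (P? : Decidable P) where

    ∑-lower : ∀ k {f : Fin n → ℕ} → (∀ {i} → P i → k ≤ f i) → k * # P? ≤ ∑ f
    ∑-lower k {f} k≤f = subst (_≤ ∑ f) (∑-* k (χ P?)) (∑-mono λ i → pointwise i (P? i))
      where
      pointwise : ∀ i (p : Dec (P i)) → k * 𝟙 p ≤ f i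
      pointwise i (yes p) = subst (_≤ f i) (sym (*-identityʳ k)) (k≤f p)
      pointwise i (no _)  = subst (_≤ f i) (sym (*-zeroʳ k)) z≤n

    ∑-upper : ∀ k {f : Fin n → ℕ} → (∀ {i} → P i → f i ≤ k) → (∀ {i} → ¬ P i → f i ≡ 0) →
              ∑ f ≤ k * # P?
    ∑-upper k {f} f≤k f≡0 = subst (∑ f ≤_) (∑-* k (χ P?)) (∑-mono λ i → pointwise i (P? i))
      where
      pointwise : ∀ i (p : Dec (P i)) → f i ≤ k * 𝟙 p
      pointwise i (yes p) = subst (f i ≤_) (sym (*-identityʳ k)) (f≤k p)
      pointwise i (no ¬p) = subst (_≤ k * 0) (sym (f≡0 ¬p)) z≤n

    #-≤n : # P? ≤ n
    #-≤n = subst (# P? ≤_) ∑-1 (∑-mono λ i → pointwise (P? i))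
      where
      pointwise : ∀ {i} (p : Dec (P i)) → 𝟙 p ≤ 1
      pointwise (yes _) = s≤s z≤n
      pointwise (no _)  = z≤n

    module _ {Q : Pred (Fin n) 0ℓ} (Q? : Decidable Q) where

      #-mono : P ⊆ Q → # P? ≤ # Q?
      #-mono P⊆Q = ∑-mono λ i → pointwise i (P? i)
        where
        pointwise : ∀ i (p : Dec (P i)) → 𝟙 p ≤ 𝟙 (Q? i)
        pointwise i (yes p) = ≤-reflexive (sym (𝟙-yes (Q? i) (P⊆Q p)))
        pointwise i (no _)  = z≤n

      #-∪ : # (P? ∪? Q?) ≤ # P? + # Q?
      #-∪ = subst (# (P? ∪? Q?) ≤_) (sym (∑-+ (χ P?) (χ Q?))) (∑-mono λ i → pointwise (P? i) (Q? i))
        where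
        pointwise : ∀ {i} (p : Dec (P i)) (q : Dec (Q i)) → 𝟙 (p ⊎-dec q) ≤ 𝟙 p + 𝟙 q
        pointwise (yes _) _       = s≤s z≤n
        pointwise (no _)  (yes _) = s≤s z≤n
        pointwise (no _)  (no _)  = z≤n

      #-disjoint-∪ : Empty (P ∩ Q) → # P? + # Q? ≤ # (P? ∪? Q?)
      #-disjoint-∪ P∩Q=∅ =
        subst (_≤ # (P? ∪? Q?)) (sym (∑-+ (χ P?) (χ Q?))) (∑-mono λ i → pointwise i (P? i) (Q? i))
        where
        pointwise : ∀ i (p : Dec (P i)) (q : Dec (Q i)) → 𝟙 p + 𝟙 q ≤ 𝟙 (p ⊎-dec q)
        pointwise i (yes p) (yes q) = contradiction (p , q) (P∩Q=∅ i)
        pointwise i (yes _) (no _)  = s≤s z≤n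
        pointwise i (no _)  (yes _) = s≤s z≤n
        pointwise i (no _)  (no _)  = z≤n

      #-excess : # P? < # Q? → ∃[ i ] (Q i × ¬ P i)
      #-excess #P<#Q with any? (λ i → Q? i ×-dec ¬? (P? i))
      ... | yes ∃i = ∃i
      ... | no ∄i  = contradiction (∑-mono λ i → pointwise i (P? i) (Q? i)) (<⇒≱ #P<#Q)
        where
        pointwise : ∀ i (p : Dec (P i)) (q : Dec (Q i)) → 𝟙 q ≤ 𝟙 p
        pointwise i (yes _) (yes _) = s≤s z≤n
        pointwise i (yes _) (no _)  = z≤n
        pointwise i (no ¬p) (yes q) = contradiction (i , q , ¬p) ∄i
        pointwise i (no _)  (no _)  = z≤n

  #-singleton : (a : Fin n) → # (_≟ a) ≡ 1
  #-singleton {n} a = trans (cong sum (map-tabulate id (χ (_≟ a)))) (go a)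
    where
    zeros : ∀ m → sum (tabulate {n = m} (λ _ → 0)) ≡ 0
    zeros zero    = refl
    zeros (suc m) = zeros m

    go : ∀ {m} (a : Fin m) → sum (tabulate (λ i → 𝟙 (i ≟ a))) ≡ 1
    go {suc m} Fin.zero    = cong suc (zeros m)
    -- The summand at `Fin.zero` vanishes, and `𝟙 (Fin.suc i ≟ Fin.suc a)` computes to `𝟙 (i ≟ a)`
    -- because `𝟙` reads only `does`.
    go {suc m} (Fin.suc a) = go a

open Counting

-- Walks, and correctness of the search behind `dist`.

module Distance (G : Graph n) (connected : Connected G) where

  private
    variable
      u v w s : Fin n
      j k : ℕ

  Adj-sym : Adj G u v → Adj G v u
  Adj-sym {u} {v} = trans (adj-sym G v u)

  Adj-irrefl : ¬ Adj G u u
  Adj-irrefl {u} uu with () ← trans (sym uu) (adj-irr G u)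

  _++ʷ_ : Walk G u v j → Walk G v w k → Walk G u w (j + k)
  here     ++ʷ q = q
  step a p ++ʷ q = step a (p ++ʷ q)

  _∷ʳʷ_ : Walk G u v k → Adj G v w → Walk G u w (suc k)
  here     ∷ʳʷ b = step b here
  step a p ∷ʳʷ b = step a (p ∷ʳʷ b)

  reverseʷ : Walk G u v k → Walk G v u k
  reverseʷ here       = here
  reverseʷ (step a p) = reverseʷ p ∷ʳʷ Adj-sym a

  initʷ : Walk G u w (suc k) → ∃[ v ] (Walk G u v k × Adj G v w)
  initʷ (step a here)         = _ , here , a
  initʷ (step a p@(step _ _)) with v , q , b ← initʷ p = v , step a q , b

  vertexAt : Walk G u v k → Fin (suc k) → Fin n
  vertexAt {u} p          Fin.zero    = u
  vertexAt     (step _ p) (Fin.suc i) = vertexAt p i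

  takeʷ : (p : Walk G u v k) (i : Fin (suc k)) → Walk G u (vertexAt p i) (toℕ i)
  takeʷ p          Fin.zero    = here
  takeʷ (step a p) (Fin.suc i) = step a (takeʷ p i)

  dropʷ : (p : Walk G u v k) (i : Fin (suc k)) → Walk G (vertexAt p i) v (k ∸ toℕ i)
  dropʷ p          Fin.zero    = p
  dropʷ (step a p) (Fin.suc i) = dropʷ p i

  -- A walk of `k ≥ n` steps has more than `n` positions, so two of them carry the same vertex and
  -- the stretch between them can be cut out.
  shorten : n < suc k → Walk G u v k → ∃[ j ] (j < k × Walk G u v j)
  shorten {k = k} {u} {v} n<1+k p with i , j , i<j , pᵢ≡pⱼ ← pigeonhole n<1+k (vertexAt p) =
    toℕ i + (k ∸ toℕ j) ,
    subst (toℕ i + (k ∸ toℕ j) <_) (m+[n∸m]≡n (≤-pred (toℕ<n j))) (+-monoˡ-< (k ∸ toℕ j) i<j) ,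
    takeʷ p i ++ʷ subst (λ x → Walk G x v _) (sym pᵢ≡pⱼ) (dropʷ p j)

  -- The search in `dist` never passes `n`, so it finds a genuine distance only if some walk is this
  -- short.
  walk≤n : ∀ u v → ∃[ j ] (j ≤ n × Walk G u v j)
  walk≤n u v = go (<-wellFounded _) (proj₂ (connected u v))
    where
    go : Acc _<_ k → Walk G u v k → ∃[ j ] (j ≤ n × Walk G u v j)
    go {k} (acc rec) p with k ≤? n
    ... | yes k≤n = k , k≤n , p
    ... | no  k≰n with j , j<k , q ← shorten (m<n⇒m<1+n (≰⇒> k≰n)) p = go (rec j<k) q

  reach-sound : ∀ k → T (reach G k u v) → ∃[ j ] (j ≤ k × Walk G u v j)
  reach-sound zero    r with refl ← toWitness r = 0 , z≤n , here
  reach-sound (suc k) r with Equivalence.to T-∨ r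
  ... | inj₁ r′ with j , j≤k , p ← reach-sound k r′ = j , m≤n⇒m≤1+n j≤k , p
  ... | inj₂ r′ with w , r″ ← Any.satisfied (any⁻ _ (allFin n) r′)
                with r‴ , a ← Equivalence.to T-∧ r″
                with j , j≤k , p ← reach-sound k r‴ =
    suc j , s≤s j≤k , p ∷ʳʷ Equivalence.to T-≡ a

  reach-complete : ∀ k → Walk G u v k → T (reach G k u v)
  reach-complete zero    here = fromWitness refl
  reach-complete (suc k) p with w , q , a ← initʷ p =
    Equivalence.from T-∨ (inj₂ (any⁺ _ (lose (∈-allFin w)
      (Equivalence.from T-∧ (reach-complete k q , Equivalence.from T-≡ a)))))

  -- When the fuel runs out, `firstTrue` returns `k` untested; the two bounds on `j` then force `j`
  -- to be `k`. A walk of length exactly `n` is therefore admissible in `d-walk`.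
  firstTrue-true : ∀ p k f → T (p j) → k ≤ j → j ≤ k + f → T (p (firstTrue G p k f))
  firstTrue-true p k zero pj k≤j j≤k+0 =
    subst (T ∘ p) (≤-antisym (subst (_ ≤_) (+-identityʳ k) j≤k+0) k≤j) pj
  firstTrue-true {j} p k (suc f) pj k≤j j≤k+1+f with p k in pk
  ... | true  = Equivalence.from T-≡ pk
  ... | false = firstTrue-true p (suc k) f pj
    (≤∧≢⇒< k≤j λ { refl → subst T pk pj }) (subst (j ≤_) (+-suc k f) j≤k+1+f)

  firstTrue-min : ∀ p k f → T (p j) → k ≤ j → firstTrue G p k f ≤ j
  firstTrue-min p k zero    pj k≤j = k≤j
  firstTrue-min p k (suc f) pj k≤j with p k in pk
  ... | true  = k≤j
  ... | false = firstTrue-min p (suc k) f pj (≤∧≢⇒< k≤j λ { refl → subst T pk pj })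

  -- Opaque because conversion checking otherwise unfolds dist into its breadth-first search.
  opaque
    d : Fin n → Fin n → ℕ
    d = dist G

    d≡dist : ∀ u v → d u v ≡ dist G u v
    d≡dist u v = refl

    d-min : Walk G u v k → d u v ≤ k
    d-min {u} {v} p = firstTrue-min (λ k → reach G k u v) 0 n (reach-complete _ p) z≤n

    d-walk : ∀ u v → Walk G u v (d u v)
    d-walk u v with j , j≤n , p ← walk≤n u v
               with i , i≤d , q ← reach-sound (d u v)
                      (firstTrue-true (λ k → reach G k u v) 0 n (reach-complete j p) z≤n j≤n) =
      -- The search only promises a walk of length `i ≤ d u v`; `d-min` applied to this walk gives
      -- the reverse inequality.
      subst (Walk G u v) (≤-antisym i≤d (d-min q)) q

  d-refl : ∀ u → d u u ≡ 0
  d-refl u = n≤0⇒n≡0 (d-min {u} here)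

  d≡0⇒≡ : d u v ≡ 0 → u ≡ v
  d≡0⇒≡ {u} {v} d≡0 with here ← subst (Walk G u v) d≡0 (d-walk u v) = refl

  d-sym : ∀ u v → d u v ≡ d v u
  d-sym u v = ≤-antisym (d-min (reverseʷ (d-walk v u))) (d-min (reverseʷ (d-walk u v)))

  d-triangle : ∀ u v w → d u w ≤ d u v + d v w
  d-triangle u v w = d-min (d-walk u v ++ʷ d-walk v w)

  d-edge : Adj G v w → ∀ s → d s w ≤ suc (d s v)
  d-edge {v} a s = d-min (d-walk s v ∷ʳʷ a)

  -- The last vertex before `u` on a shortest walk from `s`: that walk bounds its distance from
  -- above, and `d-edge` bounds it from below.
  parent : d s u ≡ suc k → ∃[ w ] (Adj G u w × d s w ≡ k)
  parent {s} {u} eq with w , p , a ← initʷ (subst (Walk G s u) eq (d-walk s u)) =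
    w , Adj-sym a , ≤-antisym (d-min p) (≤-pred (subst (_≤ suc (d s w)) eq (d-edge a s)))

-- Acyclicity and the levels of distance from a fixed vertex.

linked-∷ʳ : {A : Set} {R : A → A → Set} (xs : List A) {y z : A} →
            Linked R (xs ++ [ y ]) → R y z → Linked R ((xs ++ [ y ]) ++ [ z ])
linked-∷ʳ []            _         r = r ∷ [-]
linked-∷ʳ (_ ∷ [])      (r′ ∷ rs) r = r′ ∷ linked-∷ʳ [] rs r
linked-∷ʳ (_ ∷ x′ ∷ xs) (r′ ∷ rs) r = r′ ∷ linked-∷ʳ (x′ ∷ xs) rs r

module Tree (G : Graph n) (tree : IsTree G) where

  open Distance G (proj₁ tree)

  private
    variable
      u v w x y z a b s e : Fin n
      k : ℕ

  -- Inner vertices below level `k` keep the path away from anything at level `k` or above. At least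
  -- one inner vertex `m` is required, so that joining the ends by an edge gives a cycle of at least
  -- three vertices.
  Detour : Fin n → ℕ → Fin n → Fin n → Set
  Detour s k u w = ∃[ m ] ∃[ ms ]
    (Linked (Adj G) (u ∷ m ∷ ms ++ [ w ]) × Unique (u ∷ m ∷ ms ++ [ w ]) ×
     All (λ t → d s t < k) (m ∷ ms))

  unique-ends : ∀ {ts} → u ≢ w → d s u ≡ k → d s w ≡ k → All (λ t → d s t < k) ts → Unique ts →
                Unique (u ∷ ts ++ [ w ])
  unique-ends u≢w du dw low unique =
    All.++⁺ (All.map (λ { t<k refl → <⇒≢ t<k du }) low) (u≢w ∷ []) ∷
    AllPairs.++⁺ unique ([] ∷ []) (All.map (λ t<k → (λ { refl → <⇒≢ t<k dw }) ∷ []) low)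

  -- Descend from u and w towards s in parallel until the two descents meet.
  detour : ∀ k → u ≢ w → d s u ≡ k → d s w ≡ k → Detour s k u w
  detour zero    u≢w du dw = contradiction (trans (sym (d≡0⇒≡ du)) (d≡0⇒≡ dw)) u≢w
  detour (suc k) u≢w du dw with parent du | parent dw
  ... | u′ , uu′ , du′ | w′ , ww′ , dw′ with u′ ≟ w′
  ...   | yes refl = u′ , [] , uu′ ∷ Adj-sym ww′ ∷ [-] , unique-ends u≢w du dw low ([] ∷ []) , low
    where low = ≤-reflexive (cong suc du′) ∷ []
  ...   | no u′≢w′ with m , ms , linked , unique , low ← detour k u′≢w′ du′ dw′ =
    u′ , m ∷ ms ++ [ w′ ] , uu′ ∷ linked-∷ʳ (u′ ∷ m ∷ ms) linked (Adj-sym ww′) ,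
    unique-ends u≢w du dw low′ unique , low′
    where
    low′ = ≤-reflexive (cong suc du′) ∷
           All.++⁺ (All.map m<n⇒m<1+n low) (≤-reflexive (cong suc dw′) ∷ [])

  -- Trees are bipartite: an edge inside a level would close a `Detour` between its ends to a cycle.
  -- The cases on the inner vertices only expose the third vertex that `HasCycle` names.
  levels-differ : Adj G u w → d s u ≢ d s w
  levels-differ {u} {w} {s} uw du≡dw
    with detour (d s w) (λ { refl → Adj-irrefl uw }) du≡dw refl
  ... | m , []      , linked , unique , _ =
    proj₂ tree (u , m , w , [] , unique , linked-∷ʳ (u ∷ m ∷ []) linked (Adj-sym uw))
  ... | m , m′ ∷ ms , linked , unique , _ =
    proj₂ tree (u , m , m′ , ms ++ [ w ] , unique ,
                linked-∷ʳ (u ∷ m ∷ m′ ∷ ms) linked (Adj-sym uw))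

  -- The two sides of an edge.

  -- For an edge zw: s lies in the component of w after the edge is removed.
  Behind : Fin n → Fin n → Pred (Fin n) 0ℓ
  Behind z w s = d s z ≡ suc (d s w)

  behind? : ∀ z w → Decidable (Behind z w)
  behind? z w s = d s z ≟ℕ suc (d s w)

  behind-asym : Behind z w s → ¬ Behind w z s
  behind-asym p q = m≢1+n+m _ {1} (trans p (cong suc q))

  sides : Adj G z w → ∀ s → Behind z w s ⊎ Behind w z s
  sides {z} {w} zw s with <-cmp (d s z) (d s w)
  ... | tri< z<w _ _ = inj₂ (≤-antisym (d-edge zw s) z<w)
  ... | tri≈ _ z≈w _ = ⊥-elim (levels-differ zw z≈w)
  ... | tri> _ _ w<z = inj₁ (≤-antisym (d-edge (Adj-sym zw) s) w<z)

  towards : s ≢ z → ∃[ w ] (Adj G z w × Behind z w s)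
  towards {s} {z} s≢z with d s z in eq
  ... | zero  = contradiction (d≡0⇒≡ eq) s≢z
  ... | suc k with w , zw , dw ← parent eq = w , zw , cong suc (sym dw)

  -- Two different neighbours of `z` towards `s` would lie on one level; a `Detour` between them,
  -- closed through `z` one level higher, would be a cycle.
  behind-unique : Adj G z w → Adj G z x → Behind z w s → Behind z x s → w ≡ x
  behind-unique {z} {w} {x} {s} zw zx pw px with w ≟ x
  ... | yes w≡x = w≡x
  ... | no  w≢x with m , ms , linked , unique , low ←
                  detour (d s w) w≢x refl (suc-injective (trans (sym px) pw)) =
    contradiction
      (z , w , m , ms ++ [ x ] ,
       All.++⁺ {xs = w ∷ m ∷ ms}
         ((λ { refl → 1+n≢n (sym pw) }) ∷
          All.map (λ { t<dw refl → <⇒≱ t<dw (subst (d s w ≤_) (sym pw) (n≤1+n _)) }) low)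
         ((λ { refl → Adj-irrefl zx }) ∷ []) ∷ unique ,
       zw ∷ linked-∷ʳ (w ∷ m ∷ ms) linked (Adj-sym zx))
      (proj₂ tree)

  behind-self : Adj G z w → Behind z w w
  behind-self {z} {w} zw with sides zw w
  ... | inj₁ p = p
  ... | inj₂ p with () ← trans (sym (d-refl w)) p

  ¬behind-near : ¬ Behind z w z
  ¬behind-near {z} p with () ← trans (sym (d-refl z)) p

  -- If `s` were on the side of `z`, then `z` and `y` would be two different neighbours of `x`
  -- towards `s`.
  behind-nested : Adj G z x → Adj G x y → z ≢ y → Behind x y ⊆ Behind z x
  behind-nested zx xy z≢y {s} p with sides zx s
  ... | inj₁ q = q
  ... | inj₂ q = contradiction (behind-unique (Adj-sym zx) xy q p) z≢y

  -- Degrees as cardinalities of neighbourhoods.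

  adj? : ∀ z → Decidable (Adj G z)
  adj? z w = adj G z w ≟ᵇ true

  deg≡# : ∀ z → deg G z ≡ # (adj? z)
  deg≡# z = ∑-cong pointwise
    where
    pointwise : ∀ w → (if adj G z w then 1 else 0) ≡ χ (adj? z) w
    pointwise w with adj G z w
    ... | true  = refl
    ... | false = refl

  pair : ∀ a b → Decidable (λ (i : Fin n) → i ≡ a ⊎ i ≡ b)
  pair a b = (_≟ a) ∪? (_≟ b)

  #-pair≤2 : ∀ a b → # (pair a b) ≤ 2
  #-pair≤2 a b = ≤-trans (#-∪ (_≟ a) (_≟ b)) (≤-reflexive (cong₂ _+_ (#-singleton a) (#-singleton b)))

  2≤#-pair : a ≢ b → 2 ≤ # (pair a b)
  2≤#-pair {a} {b} a≢b = subst (_≤ # (pair a b)) (cong₂ _+_ (#-singleton a) (#-singleton b))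
    (#-disjoint-∪ (_≟ a) (_≟ b) λ { _ (refl , refl) → a≢b refl })

  another-neighbour : 2 ≤ deg G z → ∀ a → ∃[ b ] (Adj G z b × b ≢ a)
  another-neighbour {z} 2≤deg a = #-excess (_≟ a) (adj? z)
    (subst₂ _<_ (sym (#-singleton a)) (deg≡# z) 2≤deg)

  third-neighbour : 3 ≤ deg G z → ∀ a b → ∃[ c ] (Adj G z c × c ≢ a × c ≢ b)
  third-neighbour {z} 3≤deg a b
    with c , zc , c∉ ← #-excess (pair a b) (adj? z)
                         (≤-<-trans (#-pair≤2 a b) (subst (2 <_) (deg≡# z) 3≤deg)) =
    c , zc , c∉ ∘ inj₁ , c∉ ∘ inj₂

  1≤deg : Adj G z a → 1 ≤ deg G z
  1≤deg {z} {a} za = subst₂ _≤_ (#-singleton a) (sym (deg≡# z))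
    (#-mono (_≟ a) (adj? z) λ { refl → za })

  deg≤1⇒≡ : deg G z ≤ 1 → Adj G z a → Adj G z b → a ≡ b
  deg≤1⇒≡ {z} {a} {b} deg≤1 za zb with a ≟ b
  ... | yes a≡b = a≡b
  ... | no  a≢b = contradiction deg≤1 (<⇒≱ (≤-trans (2≤#-pair a≢b)
    (subst (# (pair a b) ≤_) (sym (deg≡# z))
      (#-mono (pair a b) (adj? z) λ { (inj₁ refl) → za ; (inj₂ refl) → zb }))))

  deg≤2⇒≡ : deg G z ≤ 2 → Adj G z a → Adj G z b → a ≢ b → Adj G z y → y ≡ a ⊎ y ≡ b
  deg≤2⇒≡ {z} {a} {b} {y} deg≤2 za zb a≢b zy with pair a b y
  ... | yes y∈ = y∈
  ... | no  y∉ = contradiction deg≤2 (<⇒≱ (begin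
    3                            ≤⟨ +-mono-≤ (2≤#-pair a≢b) (≤-reflexive (sym (#-singleton y))) ⟩
    # (pair a b) + # (_≟ y)      ≤⟨ #-disjoint-∪ (pair a b) (_≟ y) (λ { _ (i∈ , refl) → y∉ i∈ }) ⟩
    # (pair a b ∪? (_≟ y))       ≤⟨ #-mono (pair a b ∪? (_≟ y)) (adj? z) (λ
      { (inj₁ (inj₁ refl)) → za ; (inj₁ (inj₂ refl)) → zb ; (inj₂ refl) → zy }) ⟩
    # (adj? z)                   ≡⟨ deg≡# z ⟨
    deg G z                      ∎))
    where open ≤-Reasoning

  -- From `e`, the neighbour towards another vertex `s` could only be `z`, which points to the wrong
  -- side.
  behind-leaf : deg G e ≤ 1 → Adj G z e → Behind z e s → s ≡ e
  behind-leaf {e} {z} {s} deg≤1 ze p with s ≟ e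
  ... | yes s≡e = s≡e
  ... | no  s≢e with w , ew , q ← towards s≢e with refl ← deg≤1⇒≡ deg≤1 ew (Adj-sym ze) =
    contradiction q (behind-asym p)

  behind-deg2 : deg G x ≤ 2 → Adj G z x → Adj G x y → z ≢ y →
                Behind z x s → s ≡ x ⊎ Behind x y s
  behind-deg2 {x} {z} {y} {s} deg≤2 zx xy z≢y p with s ≟ x
  ... | yes s≡x = inj₁ s≡x
  ... | no  s≢x with w , xw , q ← towards s≢x with deg≤2⇒≡ deg≤2 (Adj-sym zx) xy z≢y xw
  ...   | inj₁ refl = contradiction q (behind-asym p)
  ...   | inj₂ refl = inj₂ q

  -- Sizes of sides, and pendant paths.

  size : Fin n → Fin n → ℕ
  size z w = # (behind? z w)

  1≤size : Adj G z w → 1 ≤ size z w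
  1≤size {z} {w} zw = subst (_≤ size z w) (#-singleton w)
    (#-mono (_≟ w) (behind? z w) λ { refl → behind-self zw })

  size-nested : Adj G z x → Adj G x y → z ≢ y → size x y < size z x
  size-nested {z} {x} {y} zx xy z≢y = begin
    1 + size x y                     ≡⟨ cong (_+ size x y) (#-singleton x) ⟨
    # (_≟ x) + size x y              ≤⟨ #-disjoint-∪ (_≟ x) (behind? x y)
                                          (λ { _ (refl , p) → ¬behind-near p }) ⟩
    # ((_≟ x) ∪? behind? x y)        ≤⟨ #-mono ((_≟ x) ∪? behind? x y) (behind? z x)
      Sum.[ (λ { refl → behind-self zx }) , behind-nested zx xy z≢y ] ⟩
    size z x                         ∎
    where open ≤-Reasoning

  size-fork : Adj G z x → Adj G x a → Adj G x b → z ≢ a → z ≢ b → a ≢ b →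
              size x a + size x b ≤ size z x
  size-fork {z} {x} {a} {b} zx xa xb z≢a z≢b a≢b = ≤-trans
    (#-disjoint-∪ (behind? x a) (behind? x b) λ _ (p , q) → a≢b (behind-unique xa xb p q))
    (#-mono (behind? x a ∪? behind? x b) (behind? z x)
      Sum.[ behind-nested zx xa z≢a , behind-nested zx xb z≢b ])

  -- The path part of `Thread`, with `z` of arbitrary degree: the tail of such a path is again one,
  -- so inductions can peel off its first vertex.
  Pendant : Fin n → List (Fin n) → Fin n → Set
  Pendant z us e = Unique (z ∷ us ++ [ e ]) × Linked (Adj G) (z ∷ us ++ [ e ]) ×
                   All (λ x → deg G x ≡ 2) us × deg G e ≡ 1

  pendant-tail : ∀ us → Pendant z (x ∷ us) e → Pendant x us e
  pendant-tail us (_ ∷ unique , _ ∷ linked , _ ∷ degs , deg-e) = unique , linked , degs , deg-e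

  pendant-adj : ∀ us → Pendant z us e → Adj G z (first G us e)
  pendant-adj []       (_ , ze ∷ _ , _) = ze
  pendant-adj (x ∷ us) (_ , zx ∷ _ , _) = zx

  pendant-skip : ∀ us → Pendant z (x ∷ us) e → z ≢ first G us e
  pendant-skip []       ((_ ∷ z≢e ∷ _) ∷ _ , _) = z≢e
  pendant-skip (y ∷ us) ((_ ∷ z≢y ∷ _) ∷ _ , _) = z≢y

  pendant-behind : ∀ us → Pendant z us e → All (Behind z (first G us e)) (us ++ [ e ])
  pendant-behind []       p = behind-self (pendant-adj [] p) ∷ []
  pendant-behind (x ∷ us) p = behind-self (pendant-adj (x ∷ us) p) ∷
    All.map (behind-nested (pendant-adj (x ∷ us) p) (pendant-adj us (pendant-tail us p))
              (pendant-skip us p))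
            (pendant-behind us (pendant-tail us p))

  -- Peeling off vertices with `behind-deg2` shows that only the path itself lies on this side.
  -- Hence no branch vertex does, as `threads-apart` needs.
  pendant-deg : ∀ us → Pendant z us e → Behind z (first G us e) s → deg G s ≤ 2
  pendant-deg [] p@(_ , _ , _ , deg-e) q
    with refl ← behind-leaf (≤-reflexive deg-e) (pendant-adj [] p) q =
    ≤-trans (≤-reflexive deg-e) (n≤1+n 1)
  pendant-deg (x ∷ us) p@(_ , _ , deg-x ∷ _ , _) q
    with behind-deg2 (≤-reflexive deg-x) (pendant-adj (x ∷ us) p) (pendant-adj us (pendant-tail us p))
                     (pendant-skip us p) q
  ... | inj₁ refl = ≤-reflexive deg-x
  ... | inj₂ r    = pendant-deg us (pendant-tail us p) r

  pendant-size : ∀ us → Pendant z us e → size z (first G us e) ≡ threadLen G us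
  pendant-size {z} {e} [] p@(_ , _ , _ , deg-e) = ≤-antisym
    (subst (size z e ≤_) (#-singleton e)
      (#-mono (behind? z e) (_≟ e) (behind-leaf (≤-reflexive deg-e) (pendant-adj [] p))))
    (1≤size (pendant-adj [] p))
  pendant-size {z} {e} (x ∷ us) p@(_ , _ , deg-x ∷ _ , _) = trans
    (≤-antisym
      (≤-trans
        (#-mono (behind? z x) ((_≟ x) ∪? behind? x x′)
          (behind-deg2 (≤-reflexive deg-x) zx xx′ (pendant-skip us p)))
        (subst (# ((_≟ x) ∪? behind? x x′) ≤_) (cong (_+ size x x′) (#-singleton x))
          (#-∪ (_≟ x) (behind? x x′))))
      (size-nested zx xx′ (pendant-skip us p)))
    (cong suc (pendant-size us (pendant-tail us p)))
    where
    x′ = first G us e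
    zx = pendant-adj (x ∷ us) p
    xx′ = pendant-adj us (pendant-tail us p)

  -- The edge zw as the only passage between its two sides.

  crossing : Adj G z w → Adj G a b → Behind z w a → Behind w z b → b ≡ z
  crossing {z} {w} {a} {b} zw ab pa pb with sides ab z
  -- If `b` is farther from `z` than `a`, then `d w b` exceeds `d w a` by three, too much for an
  -- edge.
  ... | inj₂ q = contradiction (d-edge ab w) (<⇒≱ (begin-strict
    suc (d w a)        ≡⟨ cong suc (d-sym w a) ⟩
    suc (d a w)        ≡⟨ pa ⟨
    d a z              ≡⟨ d-sym a z ⟩
    d z a              <⟨ n<1+n _ ⟩
    suc (d z a)        ≡⟨ q ⟨
    d z b              ≡⟨ d-sym z b ⟩
    d b z              <⟨ n<1+n _ ⟩
    suc (d b z)        ≡⟨ pb ⟨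
    d b w              ≡⟨ d-sym b w ⟩
    d w b              ∎))
    where open ≤-Reasoning
  ... | inj₁ q = go (d a w) refl
    where
    dbz≡daw : d b z ≡ d a w
    dbz≡daw = suc-injective (trans (trans (cong suc (d-sym b z)) (sym q)) (trans (d-sym z a) pa))

    go : ∀ k → d a w ≡ k → b ≡ z
    go zero    daw≡0 = d≡0⇒≡ (trans dbz≡daw daw≡0)
    -- Here `a` is not `w`. Its neighbour `a′` towards `w` is also nearer to `z` than `a`, so it is
    -- `b` by `behind-unique`; but `b` is farther from `w` than `a`.
    go (suc k) daw≡1+k with a′ , aa′ , dwa′ ← parent (trans (d-sym w a) daw≡1+k) =
      contradiction (trans (d-sym w b) (trans pb (cong suc (trans dbz≡daw (d-sym a w)))))
        (behind-asym (subst (λ t → d w a ≡ suc (d w t)) a′≡b dwa≡))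
      where
      dwa≡ : d w a ≡ suc (d w a′)
      dwa≡ = trans (d-sym w a) (trans daw≡1+k (cong suc (sym dwa′)))

      dza′≤ : d z a′ ≤ d w a
      dza′≤ = begin
        d z a′          ≡⟨ d-sym z a′ ⟩
        d a′ z          ≤⟨ d-edge (Adj-sym zw) a′ ⟩
        suc (d a′ w)    ≡⟨ cong suc (d-sym a′ w) ⟩
        suc (d w a′)    ≡⟨ dwa≡ ⟨
        d w a           ∎
        where open ≤-Reasoning

      a′≡b : a′ ≡ b
      a′≡b with sides aa′ z
      ... | inj₁ r = behind-unique aa′ ab r q
      ... | inj₂ r = contradiction dza′≤ (<⇒≱ (begin-strict
        d w a          ≡⟨ d-sym w a ⟩
        d a w          <⟨ n<1+n _ ⟩
        suc (d a w)    ≡⟨ pa ⟨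
        d a z          ≡⟨ d-sym a z ⟩
        d z a          <⟨ n<1+n _ ⟩
        suc (d z a)    ≡⟨ r ⟨
        d z a′         ∎))
        where open ≤-Reasoning

  -- By `crossing`, the walk enters the side of `z` at `z` itself and splits there into a walk from
  -- `s` to `z` and one from `z` to `y`.
  walk-through : Adj G z w → Walk G s y k → Behind z w s → Behind w z y → d s z + d z y ≤ k
  walk-through zw here ps py = contradiction py (behind-asym ps)
  walk-through {z} {w} {s} {y} {suc k} zw (step {w = b} sb p) ps py with sides zw b
  ... | inj₁ pb = begin
    d s z + d z y         ≡⟨ cong (_+ d z y) (d-sym s z) ⟩
    d z s + d z y         ≤⟨ +-monoˡ-≤ (d z y) (d-edge (Adj-sym sb) z) ⟩
    suc (d z b + d z y)   ≡⟨ cong (λ t → suc (t + d z y)) (d-sym z b) ⟩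
    suc (d b z + d z y)   ≤⟨ s≤s (walk-through zw p pb py) ⟩
    suc k                 ∎
    where open ≤-Reasoning
  ... | inj₂ pb with refl ← crossing zw sb ps pb = +-mono-≤ (d-min (step sb here)) (d-min p)

  separated : Adj G z w → Behind z w s → Behind w z y → d s z + d z y ≤ d s y
  separated {s = s} {y = y} zw = walk-through zw (d-walk s y)

  not-behind : Adj G z a → Adj G z b → a ≢ b → Behind z a s → Behind b z s
  not-behind {s = s} za zb a≢b pa with sides zb s
  ... | inj₁ pb = contradiction (behind-unique za zb pa pb) a≢b
  ... | inj₂ pb = pb

  -- Bounds on the resolution sum of a pair.

  Δ : Fin n → Fin n → ℕ
  Δ x y = ∑ (λ s → ∣ d x s - d y s ∣)

  ΔS≤Δ : ∀ S x y → ΔS G S x y ≤ Δ x y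
  ΔS≤Δ S x y = ∑-mono pointwise
    where
    pointwise : ∀ s → (if lookup S s then ∣ dist G x s - dist G y s ∣ else 0) ≤ ∣ d x s - d y s ∣
    pointwise s with lookup S s
    ... | true  = ≤-reflexive (sym (cong₂ ∣_-_∣ (d≡dist x s) (d≡dist y s)))
    ... | false = z≤n

  Δ≤ΔS⊤ : ∀ x y → Δ x y ≤ ΔS G ⊤ x y
  Δ≤ΔS⊤ x y = ∑-mono pointwise
    where
    pointwise : ∀ s → ∣ d x s - d y s ∣ ≤ (if lookup ⊤ s then ∣ dist G x s - dist G y s ∣ else 0)
    pointwise s rewrite lookup-replicate s true = ≤-reflexive (cong₂ ∣_-_∣ (d≡dist x s) (d≡dist y s))

  -- The midpoint of the path from `x` to `y`, with its two neighbours on that path.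
  record Meet (x y : Fin n) : Set where
    field
      {centre left right} : Fin n
      centre-left   : Adj G centre left
      centre-right  : Adj G centre right
      left≢right    : left ≢ right
      behind-left   : Behind centre left x
      behind-right  : Behind centre right y
      equidistant   : d x centre ≡ d y centre

  -- From an equidistant `z`, move towards `x` and `y` as long as the first steps agree. They must
  -- part before the distance reaches 0, since `x` and `y` differ.
  meet : ∀ k z → x ≢ y → d x z ≡ k → d y z ≡ k → Meet x y
  meet zero    z x≢y dx dy = contradiction (trans (d≡0⇒≡ dx) (sym (d≡0⇒≡ dy))) x≢y
  meet (suc k) z x≢y dx dy with parent dx | parent dy
  ... | a , za , da | b , zb , db with a ≟ b
  ...   | yes refl = meet k a x≢y da db
  ...   | no  a≢b  = record
    { centre-left = za ; centre-right = zb ; left≢right = a≢b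
    ; behind-left = trans dx (cong suc (sym da)) ; behind-right = trans dy (cong suc (sym db))
    ; equidistant = trans dx (sym dy) }

  -- The path from `s` to `y` runs through `z`, whereas going from `x` to `s` by way of `a` saves
  -- the edge between `a` and `z` twice.
  gap : Adj G z a → Adj G z b → a ≢ b → Behind z a x → Behind z b y → d x z ≡ d y z →
        Behind z a s → 2 ≤ ∣ d x s - d y s ∣
  gap {z} {a} {b} {x} {y} {s} za zb a≢b px py eq ps = begin
    2                      ≤⟨ m+n≤o⇒m≤o∸n 2 2+dxs≤dys ⟩
    d y s ∸ d x s          ≤⟨ m∸n≤∣m-n∣ (d y s) (d x s) ⟩
    ∣ d y s - d x s ∣      ≡⟨ ∣-∣-comm (d y s) (d x s) ⟩
    ∣ d x s - d y s ∣      ∎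
    where
    open ≤-Reasoning
    2+dxs≤dys : 2 + d x s ≤ d y s
    2+dxs≤dys = begin
      2 + d x s                    ≤⟨ s≤s (s≤s (d-triangle x a s)) ⟩
      2 + (d x a + d a s)          ≡⟨ cong suc (+-suc (d x a) (d a s)) ⟨
      suc (d x a) + suc (d a s)    ≡⟨ cong₂ _+_ (sym px) (trans (cong suc (d-sym a s)) (sym ps)) ⟩
      d x z + d s z                ≡⟨ cong (_+ d s z) (trans eq (d-sym y z)) ⟩
      d z y + d s z                ≡⟨ +-comm (d z y) (d s z) ⟩
      d s z + d z y                ≤⟨ separated za ps (not-behind zb za (a≢b ∘ sym) py) ⟩
      d s y                        ≡⟨ d-sym s y ⟩
      d y s                        ∎

  Δ-lower : (m : Meet x y) → let open Meet m in 2 * (size centre left + size centre right) ≤ Δ x y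
  Δ-lower {x} {y} m = ≤-trans
    (*-monoʳ-≤ 2 (#-disjoint-∪ (behind? centre left) (behind? centre right)
      λ _ (p , q) → left≢right (behind-unique centre-left centre-right p q)))
    (∑-lower (behind? centre left ∪? behind? centre right) 2 λ
      { (inj₁ p) → gap centre-left centre-right left≢right behind-left behind-right equidistant p
      ; {s} (inj₂ p) → subst (2 ≤_) (∣-∣-comm (d y s) (d x s))
          (gap centre-right centre-left (left≢right ∘ sym) behind-right behind-left
            (sym equidistant) p) })
    where open Meet m

  Δ-siblings : Adj G z a → Adj G z b → a ≢ b → Δ a b ≤ 2 * (size z a + size z b)
  Δ-siblings {z} {a} {b} za zb a≢b = ≤-trans
    (∑-upper (behind? z a ∪? behind? z b) 2 within outside)
    (*-monoʳ-≤ 2 (#-∪ (behind? z a) (behind? z b)))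
    where
    two-apart : ∀ i j k → i ≡ suc j → k ≡ suc i → ∣ j - k ∣ ≤ 2
    two-apart _ j _ refl refl = ≤-reflexive (trans (cong ∣ j -_∣ (+-comm 2 j)) (∣m-m+n∣≡n j 2))

    within : Behind z a s ⊎ Behind z b s → ∣ d a s - d b s ∣ ≤ 2
    -- As `s` is not behind `b`, the values `d s a`, `d s z`, `d s b` are consecutive.
    within {s} (inj₁ p) rewrite d-sym a s | d-sym b s =
      two-apart (d s z) (d s a) (d s b) p (not-behind za zb a≢b p)
    within {s} (inj₂ p) rewrite d-sym a s | d-sym b s | ∣-∣-comm (d s a) (d s b) =
      two-apart (d s z) (d s b) (d s a) p (not-behind zb za (a≢b ∘ sym) p)

    outside : ¬ (Behind z a s ⊎ Behind z b s) → ∣ d a s - d b s ∣ ≡ 0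
    outside {s} ∉ with sides za s | sides zb s
    ... | inj₁ p | _      = contradiction (inj₁ p) ∉
    ... | inj₂ _ | inj₁ q = contradiction (inj₂ q) ∉
    ... | inj₂ p | inj₂ q = m≡n⇒∣m-n∣≡0 (trans (d-sym a s) (trans p (trans (sym q) (d-sym s b))))

  Δ-edge : Adj G a b → Δ a b ≤ n
  Δ-edge {a} {b} ab = ∑≤n pointwise
    where
    one-apart : ∀ i j → i ≡ suc j → ∣ i - j ∣ ≤ 1
    one-apart _ j refl = ≤-reflexive (trans (∣-∣-comm (suc j) j)
      (trans (cong ∣ j -_∣ (+-comm 1 j)) (∣m-m+n∣≡n j 1)))

    pointwise : ∀ s → ∣ d a s - d b s ∣ ≤ 1
    pointwise s rewrite d-sym a s | d-sym b s with sides ab s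
    ... | inj₁ p = one-apart (d s a) (d s b) p
    ... | inj₂ p rewrite ∣-∣-comm (d s a) (d s b) = one-apart (d s b) (d s a) p

  -- Every vertex other than `z` lies behind a neighbour of `z`, and `a` and `b` are the only
  -- neighbours; the extra 1 counts `z`.
  covered : deg G z ≤ 2 → Adj G z a → Adj G z b → a ≢ b → n ≤ suc (size z a + size z b)
  covered {z} {a} {b} deg≤2 za zb a≢b = begin
    n                          ≤⟨ n≤∑ (λ s → ≤-reflexive (sym (𝟙-yes (cover? s) (cover s)))) ⟩
    # cover?                   ≤⟨ #-∪ (_≟ z) (behind? z a ∪? behind? z b) ⟩
    # (_≟ z) + # (behind? z a ∪? behind? z b)
      ≤⟨ +-mono-≤ (≤-reflexive (#-singleton z)) (#-∪ (behind? z a) (behind? z b)) ⟩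
    suc (size z a + size z b)  ∎
    where
    open ≤-Reasoning
    cover? = (_≟ z) ∪? (behind? z a ∪? behind? z b)

    cover : ∀ s → s ≡ z ⊎ (Behind z a s ⊎ Behind z b s)
    cover s with s ≟ z
    ... | yes s≡z = inj₁ s≡z
    ... | no  s≢z with w , zw , p ← towards s≢z with deg≤2⇒≡ deg≤2 za zb a≢b zw
    ...   | inj₁ refl = inj₂ (inj₁ p)
    ...   | inj₂ refl = inj₂ (inj₂ p)

  -- A branch vertex lies beyond any thread. So from a common `s` the path to `v` passes `u` and the
  -- path to `u` passes `v`, which forces `d u v` to be 0.
  threads-apart : ∀ {us w us′ w′} → Thread G u us w → Thread G v us′ w′ → u ≢ v →
                  Behind u (first G us w) s → ¬ Behind v (first G us′ w′) s
  threads-apart {u} {v} {s} {us} {w} {us′} {w′} (3≤deg-u , p) (3≤deg-v , q) u≢v s-u s-v =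
    u≢v (d≡0⇒≡ (n≤0⇒n≡0 (+-cancelˡ-≤ (d s u) (d u v) 0 (begin
      d s u + d u v   ≤⟨ separated (pendant-adj us p) s-u (beyond us p 3≤deg-v) ⟩
      d s v           ≤⟨ m≤m+n _ _ ⟩
      d s v + d v u   ≤⟨ separated (pendant-adj us′ q) s-v (beyond us′ q 3≤deg-u) ⟩
      d s u           ≡⟨ +-identityʳ _ ⟨
      d s u + 0       ∎))))
    where
    open ≤-Reasoning
    beyond : ∀ us → Pendant z us e → 3 ≤ deg G y → Behind (first G us e) z y
    beyond {y = y} us p 3≤deg with sides (pendant-adj us p) y
    ... | inj₁ r = contradiction (pendant-deg us p r) (<⇒≱ 3≤deg)
    ... | inj₂ r = r

-- Side sizes against a lower bound `c` for pairs of threads at one vertex.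

module Kappa (G : Graph n) (tree : IsTree G) {c : ℕ}
  (minimal : ∀ v us₁ w₁ us₂ w₂ → Thread G v us₁ w₁ → Thread G v us₂ w₂ →
             first G us₁ w₁ ≢ first G us₂ w₂ → c ≤ 2 * (threadLen G us₁ + threadLen G us₂)) where

  open Distance G (proj₁ tree)
  open Tree G tree

  minimal-size : ∀ {v} us₁ {w₁} us₂ {w₂} → Thread G v us₁ w₁ → Thread G v us₂ w₂ →
                 first G us₁ w₁ ≢ first G us₂ w₂ →
                 c ≤ 2 * (size v (first G us₁ w₁) + size v (first G us₂ w₂))
  minimal-size us₁ us₂ t₁ t₂ f≢ = ≤-trans (minimal _ us₁ _ us₂ _ t₁ t₂ f≢)
    (≤-reflexive (cong (2 *_) (sym
      (cong₂ _+_ (pendant-size us₁ (proj₂ t₁)) (pendant-size us₂ (proj₂ t₂))))))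

  IsPendant : Fin n → Fin n → Set
  IsPendant z w = ∃[ us ] ∃[ e ] (Pendant z us e × first G us e ≡ w)

  -- A branch vertex farthest from z has two pendant paths behind it, so it is a root vertex.
  branch : ∀ m {z w} → Adj G z w → size z w ≤ m → IsPendant z w ⊎ c ≤ 2 * size z w
  branch zero    zw size≤0 = contradiction (≤-trans (1≤size zw) size≤0) 1+n≰n
  branch (suc m) {z} {w} zw size≤1+m with deg G w ≤? 1
  ... | yes deg≤1 = inj₁ ([] , w ,
    (((λ { refl → Adj-irrefl zw }) ∷ []) ∷ [] ∷ [] , zw ∷ [-] , [] ,
     ≤-antisym deg≤1 (1≤deg (Adj-sym zw))) , refl)
  ... | no  deg≰1 with a , wa , a≢z ← another-neighbour (≰⇒> deg≰1) z
                  with branch m wa (≤-pred (≤-trans (size-nested zw wa (a≢z ∘ sym)) size≤1+m))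
  ...   | inj₂ heavy = inj₂ (≤-trans heavy (*-monoʳ-≤ 2 (<⇒≤ (size-nested zw wa (a≢z ∘ sym)))))
  ...   | inj₁ (us , e , p@(unique , linked , degs , deg-e) , refl) with deg G w ≤? 2
  ...     | yes deg≤2 = inj₁ (w ∷ us , e ,
    (((λ { refl → Adj-irrefl zw }) ∷ All.map z∉ (pendant-behind us p)) ∷ unique ,
     zw ∷ linked , ≤-antisym deg≤2 (≰⇒> deg≰1) ∷ degs , deg-e) , refl)
    where
    -- The path found so far lies behind `a` as seen from `w`, whereas `z` is a different neighbour
    -- of `w`.
    z∉ : ∀ {s} → Behind w a s → z ≢ s
    z∉ q refl = a≢z (sym (behind-unique (Adj-sym zw) wa (behind-self (Adj-sym zw)) q))
  ...     | no  deg≰2 with b , wb , b≢z , b≢a ← third-neighbour (≰⇒> deg≰2) z a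
                      with branch m wb (≤-pred (≤-trans (size-nested zw wb (b≢z ∘ sym)) size≤1+m))
  ...       | inj₂ heavy = inj₂ (≤-trans heavy (*-monoʳ-≤ 2 (<⇒≤ (size-nested zw wb (b≢z ∘ sym)))))
  ...       | inj₁ (us′ , e′ , p′ , refl) = inj₂ (≤-trans
    (minimal-size us us′ (≰⇒> deg≰2 , p) (≰⇒> deg≰2 , p′) (b≢a ∘ sym))
    (*-monoʳ-≤ 2 (size-fork zw wa wb (a≢z ∘ sym) (b≢z ∘ sym) (b≢a ∘ sym))))

  -- A side that is not a pendant path already yields `c`. Two pendant paths at a branch vertex are
  -- threads and yield `c` together; at a vertex of degree at most 2 they miss only `z` and yield
  -- `n`, where the 1 for `z` is absorbed by a nonempty side.
  centre-bound : ∀ {z a b} → Adj G z a → Adj G z b → a ≢ b → n ⊓ c ≤ 2 * (size z a + size z b)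
  centre-bound {z} {a} {b} za zb a≢b with branch _ za ≤-refl | branch _ zb ≤-refl
  ... | inj₂ heavy | _ =
    ≤-trans (m⊓n≤n n c) (≤-trans heavy (*-monoʳ-≤ 2 (m≤m+n (size z a) (size z b))))
  ... | inj₁ _ | inj₂ heavy =
    ≤-trans (m⊓n≤n n c) (≤-trans heavy (*-monoʳ-≤ 2 (m≤n+m (size z b) (size z a))))
  ... | inj₁ (us , e , p , refl) | inj₁ (us′ , e′ , p′ , refl) with deg G z ≤? 2
  ...   | no  deg≰2 = ≤-trans (m⊓n≤n n c)
    (minimal-size us us′ (≰⇒> deg≰2 , p) (≰⇒> deg≰2 , p′) a≢b)
  ...   | yes deg≤2 = begin
    n ⊓ c                                                 ≤⟨ m⊓n≤m n c ⟩
    n                                                     ≤⟨ covered deg≤2 za zb a≢b ⟩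
    1 + (size z a + size z b)                             ≤⟨ +-monoˡ-≤ _ (≤-trans (1≤size za) (m≤m+n _ _)) ⟩
    (size z a + size z b) + (size z a + size z b)         ≡⟨ cong (size z a + size z b +_) (+-identityʳ _) ⟨
    2 * (size z a + size z b)                             ∎
    where open ≤-Reasoning

  Δ-bound : ∀ {x y} → x ≢ y → n ⊓ c ≤ Δ x y
  Δ-bound {x} {y} x≢y with any? (λ s → d x s ≟ℕ d y s)
  ... | no  ∄s = ≤-trans (m⊓n≤m n c)
    (n≤∑ λ s → n≢0⇒n>0 λ ∣dx-dy∣≡0 → ∄s (s , ∣m-n∣≡0⇒m≡n ∣dx-dy∣≡0))
  ... | yes (s , dx≡dy) = ≤-trans (centre-bound centre-left centre-right left≢right) (Δ-lower m)
    where
    m = meet (d y s) s x≢y dx≡dy refl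
    open Meet m

  -- Trees with fewer than `c` vertices.

  pack : {P Q : Pred (Fin n) 0ℓ} (P? : Decidable P) (Q? : Decidable Q) → Empty (P ∩ Q) →
         c ≤ 2 * # P? → c ≤ 2 * # Q? → c ≤ n
  -- Doubling everything and cancelling at the end avoids halving `c`, which is not known to be even
  -- here.
  pack P? Q? P∩Q=∅ c≤P c≤Q = *-cancelˡ-≤ 2 (begin
    2 * c                    ≡⟨ cong (c +_) (+-identityʳ c) ⟩
    c + c                    ≤⟨ +-mono-≤ c≤P c≤Q ⟩
    2 * # P? + 2 * # Q?      ≡⟨ *-distribˡ-+ 2 (# P?) (# Q?) ⟨
    2 * (# P? + # Q?)        ≤⟨ *-monoʳ-≤ 2 (#-disjoint-∪ P? Q? P∩Q=∅) ⟩
    2 * # (P? ∪? Q?)         ≤⟨ *-monoʳ-≤ 2 (#-≤n (P? ∪? Q?)) ⟩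
    2 * n                    ∎)
    where open ≤-Reasoning

  behind-pair? : ∀ v a b → Decidable (Behind v a ∪ Behind v b)
  behind-pair? v a b = behind? v a ∪? behind? v b

  pair-size : ∀ {v} us₁ {w₁} us₂ {w₂} → Thread G v us₁ w₁ → Thread G v us₂ w₂ →
              first G us₁ w₁ ≢ first G us₂ w₂ →
              c ≤ 2 * # (behind-pair? v (first G us₁ w₁) (first G us₂ w₂))
  pair-size {v} us₁ us₂ t₁ t₂ f≢ = ≤-trans (minimal-size us₁ us₂ t₁ t₂ f≢)
    (*-monoʳ-≤ 2 (#-disjoint-∪ (behind? v _) (behind? v _) λ _ (p , q) →
      f≢ (behind-unique (pendant-adj us₁ (proj₂ t₁)) (pendant-adj us₂ (proj₂ t₂)) p q)))

  c≤n⊎S3 : ∀ {v} → IsRoot G v → c ≤ n ⊎ IsS3 G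
  c≤n⊎S3 {v} root@(us₁ , w₁ , us₂ , w₂ , t₁ , t₂ , f₁≢f₂) with c ≤? n
  ... | yes c≤n = inj₁ c≤n
  ... | no  c≰n = inj₂ (v , root , deg3 , unique)
    where
    f₁ = first G us₁ w₁
    f₂ = first G us₂ w₂
    vf₁ = pendant-adj us₁ (proj₂ t₁)
    vf₂ = pendant-adj us₂ (proj₂ t₂)

    pair? = behind-pair? v f₁ f₂
    c≤pair = pair-size us₁ us₂ t₁ t₂ f₁≢f₂

    avoids : ∀ {g s} → Adj G v g → g ≢ f₁ → g ≢ f₂ → (Behind v f₁ ∪ Behind v f₂) s → ¬ Behind v g s
    avoids vg g≢f₁ g≢f₂ (inj₁ p) q = g≢f₁ (behind-unique vg vf₁ q p)
    avoids vg g≢f₁ g≢f₂ (inj₂ p) q = g≢f₂ (behind-unique vg vf₂ q p)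

    deg3 : RootDeg3 G v
    deg3 with f₃ , vf₃ , f₃≢f₁ , f₃≢f₂ ← third-neighbour (proj₁ t₁) f₁ f₂
         with branch _ vf₃ ≤-refl
    -- The side of `f₃` is disjoint from the first two threads, so both being large would give
    -- `c ≤ n`.
    ... | inj₂ heavy = contradiction
      (pack pair? (behind? v f₃) (λ _ (p , q) → avoids vf₃ f₃≢f₁ f₃≢f₂ p q) c≤pair heavy) c≰n
    ... | inj₁ (us₃ , w₃ , p₃ , refl) =
      us₁ , w₁ , us₂ , w₂ , us₃ , w₃ , t₁ , t₂ , t₃ ,
      f₁≢f₂ , f₃≢f₁ ∘ sym , f₃≢f₂ ∘ sym , only
      where
      t₃ = proj₁ t₁ , p₃

      only : ∀ us w → Thread G v us w →
             first G us w ≡ f₁ ⊎ first G us w ≡ f₂ ⊎ first G us w ≡ f₃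
      only us w t with first G us w ≟ f₁ | first G us w ≟ f₂ | first G us w ≟ f₃
      ... | yes f≡f₁ | _        | _        = inj₁ f≡f₁
      ... | no  _    | yes f≡f₂ | _        = inj₂ (inj₁ f≡f₂)
      ... | no  _    | no  _    | yes f≡f₃ = inj₂ (inj₂ f≡f₃)
      -- A fourth thread and the third form a second pair, disjoint from the first.
      ... | no  f≢f₁ | no  f≢f₂ | no  f≢f₃ = contradiction
        (pack pair? (behind-pair? v (first G us w) f₃)
          (λ { _ (p , inj₁ q) → avoids (pendant-adj us (proj₂ t)) f≢f₁ f≢f₂ p q
             ; _ (p , inj₂ q) → avoids vf₃ f₃≢f₁ f₃≢f₂ p q })
          c≤pair (pair-size us us₃ t t₃ f≢f₃))
        c≰n

    unique : ∀ u → IsRoot G u → u ≡ v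
    unique u (us , w , us′ , w′ , t , t′ , f≢f′) with u ≟ v
    ... | yes u≡v = u≡v
    ... | no  u≢v = contradiction
      (pack pair? (behind-pair? u (first G us w) (first G us′ w′))
        (λ { _ (inj₁ p , inj₁ q) → threads-apart t t₁ u≢v q p
           ; _ (inj₁ p , inj₂ q) → threads-apart t′ t₁ u≢v q p
           ; _ (inj₂ p , inj₁ q) → threads-apart t t₂ u≢v q p
           ; _ (inj₂ p , inj₂ q) → threads-apart t′ t₂ u≢v q p })
        c≤pair (pair-size us us′ t t′ f≢f′))
      c≰n

-- Assembly of the upper and lower bounds.

theorem3p1 : ∀ (n : ℕ) (T : Graph n) → IsTree T → ¬ IsPathGraph T →
    ∀ (c : ℕ) → IsKappaStar T c →
    IsKappa T (n ⊓ c) × (¬ IsS3 T → IsKappa T c)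
theorem3p1 n T tree _ c
  ((v , us₁ , w₁ , us₂ , w₂ , t₁ , t₂ , f₁≢f₂ , c≡) , minimal) =
  isKappa , λ ¬S3 → subst (IsKappa T) (m≥n⇒m⊓n≡n (c≤n ¬S3)) isKappa
  where
  open Tree T tree
  open Kappa T tree minimal

  vf₁ = pendant-adj us₁ (proj₂ t₁)
  vf₂ = pendant-adj us₂ (proj₂ t₂)

  c≤n : ¬ IsS3 T → c ≤ n
  c≤n ¬S3 with c≤n⊎S3 (us₁ , w₁ , us₂ , w₂ , t₁ , t₂ , f₁≢f₂)
  ... | inj₁ c≤n = c≤n
  ... | inj₂ S3  = contradiction S3 ¬S3

  ≤c : ∀ k S → WeakResolving T k S → k ≤ c
  -- The test pair consists of the first vertices of the two threads that realise `c`.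
  ≤c k S resolving = begin
    k                                   ≤⟨ resolving f₁ f₂ f₁≢f₂ ⟩
    ΔS T S f₁ f₂                        ≤⟨ ΔS≤Δ S f₁ f₂ ⟩
    Δ f₁ f₂                             ≤⟨ Δ-siblings vf₁ vf₂ f₁≢f₂ ⟩
    2 * (size v f₁ + size v f₂)         ≡⟨ cong (2 *_) (cong₂ _+_ (pendant-size us₁ (proj₂ t₁))
                                                                  (pendant-size us₂ (proj₂ t₂))) ⟩
    2 * (threadLen T us₁ + threadLen T us₂) ≡⟨ c≡ ⟨
    c                                   ∎
    where
    open ≤-Reasoning
    f₁ = first T us₁ w₁
    f₂ = first T us₂ w₂

  ≤n : ∀ k S → WeakResolving T k S → k ≤ n
  -- Any edge serves as test pair; the one from `v` into its first thread is at hand.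
  ≤n k S resolving = ≤-trans (resolving v _ λ v≡f₁ → Adj-irrefl (subst (Adj T v) (sym v≡f₁) vf₁))
    (≤-trans (ΔS≤Δ S v _) (Δ-edge vf₁))
    where open Distance T (proj₁ tree)

  1≤n : Fin n → 1 ≤ n
  1≤n i = ≤-<-trans z≤n (toℕ<n i)

  isKappa : IsKappa T (n ⊓ c)
  -- After rewriting by `c≡`, positivity of `c` holds by computation, since `threadLen` is a
  -- successor.
  isKappa = ⊓-glb (1≤n v) (subst (1 ≤_) (sym c≡) (s≤s z≤n)) ,
            (⊤ , λ x y x≢y → ≤-trans (Δ-bound x≢y) (Δ≤ΔS⊤ x y)) ,
            λ k S _ resolving → ⊓-glb (≤n k S resolving) (≤c k S resolving)
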